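{- Let $S$ be a numerical monoid. (1) If $S'$ is a numerical monoid such that $\mathcal P_{\mathrm{fin},0}(S')$ is isomorphic to $\mathcal P_{\mathrm{fin},0}(S)$, then $|\mathcal A(S)|=|\mathcal A(S')|$ and $m(S)=m(S')$. (2) There are only finitely many numerical monoids $S'$ such that $\mathcal P_{\mathrm{fin},0}(S')$ is isomorphic to $\mathcal P_{\mathrm{fin},0}(S)$.
   Context: A numerical monoid is an additive submonoid $S\subset\mathbb N_0$ with $\gcd(S)=1$; $\mathcal A(S)$ is its set of atoms (nonzero elements of $S$ that are not a sum of two nonzero elements of $S$), which is its minimal generating set. $m(S)$ denotes the smallest integer $m\ge\max\mathcal A(S)$ such that both $m$ and $m-1$ lie in $S$. $\mathcal P_{\mathrm{fin},0}(S)$ is the monoid of finite subsets of $S$ containing $0$ under set addition $A+B=\{a+b\colon a\in A,b\in B\}$; isomorphism means monoid isomorphism. -}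

module Defs where

open import Level using (0ℓ)
open import Data.Empty using (⊥)
open import Data.Bool using (Bool; T)
open import Data.Nat using (ℕ; zero; suc; _+_; _≤_)
open import Data.Nat.GCD using (gcd)
open import Data.List using (List; []; _∷_; [_]; foldr; map; concatMap; _++_)
open import Data.List.Relation.Unary.All using (All; []; _∷_)
open import Data.List.Relation.Unary.All.Properties using (++⁺)
open import Data.List.Membership.Propositional using (_∈_)
open import Data.List.Membership.Propositional.Properties using (∈-++⁺ˡ; ∈-map⁺)
open import Data.List.Relation.Unary.Any using (here)
open import Data.Product using (Σ; ∃; ∃-syntax; _×_; _,_; proj₁)
open import Relation.Binary.PropositionalEquality using (_≡_; _≢_; refl)
open import Relation.Nullary using (¬_)
open import Function.Bundles using (_⇔_)
open import Algebra.Bundles.Raw using (RawMonoid)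
open import Algebra.Morphism.Structures using (module MonoidMorphisms)

-- A numerical monoid: a submonoid of ℕ (given by its characteristic
-- function) whose elements have gcd 1 (gcd(S) = 1 is witnessed by a
-- finite list of elements of S with gcd 1).
record NumericalMonoid : Set where
  field
    mem      : ℕ → Bool
    zero∈    : T (mem 0)
    +-closed : ∀ {a b} → T (mem a) → T (mem b) → T (mem (a + b))
    gcd≡1    : ∃[ xs ] (All (λ x → T (mem x)) xs × foldr gcd 0 xs ≡ 1)

_∈S_ : ℕ → NumericalMonoid → Set
n ∈S S = T (NumericalMonoid.mem S n)

_≐_ : NumericalMonoid → NumericalMonoid → Set
S ≐ S' = ∀ n → n ∈S S ⇔ n ∈S S'

IsAtom : NumericalMonoid → ℕ → Set
IsAtom S a = a ∈S S × a ≢ 0 ×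
  ¬ (∃[ b ] ∃[ c ] (b ∈S S × c ∈S S × b ≢ 0 × c ≢ 0 × b + c ≡ a))

-- |A(S)| = |A(S')| : a bijection between the two sets of atoms
-- (as subsets of ℕ, i.e. compared via their underlying numbers).
SameCard : (ℕ → Set) → (ℕ → Set) → Set
SameCard P Q = Σ (Σ ℕ P → Σ ℕ Q) λ f → Σ (Σ ℕ Q → Σ ℕ P) λ g →
  (∀ x → proj₁ (g (f x)) ≡ proj₁ x) × (∀ y → proj₁ (f (g y)) ≡ proj₁ y)

MCond : NumericalMonoid → ℕ → Set
MCond S zero = ⊥
MCond S (suc k) = (∀ a → IsAtom S a → a ≤ suc k) × suc k ∈S S × k ∈S S

IsMS : NumericalMonoid → ℕ → Set
IsMS S m = MCond S m × (∀ m' → MCond S m' → m ≤ m')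

-- P_fin,0(S): finite subsets of S containing 0, represented by lists;
-- two such are equal iff they have the same members.
record FinSub0 (S : NumericalMonoid) : Set where
  constructor fs
  field
    elems : List ℕ
    ⊆S    : All (λ x → x ∈S S) elems
    has0  : 0 ∈ elems
open FinSub0

sumset : List ℕ → List ℕ → List ℕ
sumset xs ys = concatMap (λ x → map (x +_) ys) xs

private
  map-all : (S : NumericalMonoid) → ∀ {x} ys → x ∈S S →
            All (λ y → y ∈S S) ys → All (λ z → z ∈S S) (map (x +_) ys)
  map-all S [] x∈ [] = []
  map-all S (y ∷ ys) x∈ (py ∷ pys) =
    NumericalMonoid.+-closed S x∈ py ∷ map-all S ys x∈ pys

  sum-all : (S : NumericalMonoid) → ∀ xs ys → All (λ x → x ∈S S) xs →
            All (λ y → y ∈S S) ys → All (λ z → z ∈S S) (sumset xs ys)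
  sum-all S [] ys [] pys = []
  sum-all S (x ∷ xs) ys (px ∷ pxs) pys =
    ++⁺ (map-all S ys px pys) (sum-all S xs ys pxs pys)

  sum0 : ∀ xs ys → 0 ∈ xs → 0 ∈ ys → 0 ∈ sumset xs ys
  sum0 (x ∷ xs) ys (here refl) p = ∈-++⁺ˡ (∈-map⁺ (0 +_) p)
  sum0 (x ∷ xs) ys (Data.List.Relation.Unary.Any.there q) p =
    Data.List.Membership.Propositional.Properties.∈-++⁺ʳ
      (map (x +_) ys) (sum0 xs ys q p)

_⊕_ : {S : NumericalMonoid} → FinSub0 S → FinSub0 S → FinSub0 S
_⊕_ {S} A B = fs (sumset (elems A) (elems B))
  (sum-all S (elems A) (elems B) (⊆S A) (⊆S B)) (sum0 (elems A) (elems B) (has0 A) (has0 B))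

Pfin0 : NumericalMonoid → RawMonoid 0ℓ 0ℓ
Pfin0 S = record
  { Carrier = FinSub0 S
  ; _≈_     = λ A B → ∀ n → n ∈ elems A ⇔ n ∈ elems B
  ; _∙_     = _⊕_
  ; ε       = fs [ 0 ] (NumericalMonoid.zero∈ S ∷ []) (here refl)
  }

_≅P_ : NumericalMonoid → NumericalMonoid → Set
S ≅P S' = Σ (FinSub0 S → FinSub0 S') λ φ →
  MonoidMorphisms.IsMonoidIsomorphism (Pfin0 S) (Pfin0 S') φ

{-# OPTIONS --safe #-}

-- Let φ : P(S) → P(S') be an isomorphism.  If a = max A, then
-- {0,a} + kA = A + kA for large k; applying φ and comparing maxima gives
-- max φ({0,a}) = max φ(A).  So max φ(A) depends only on max A, and since
-- maxima add under ⊕ this dependence is linear.  As S and S' both have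
-- gcd 1, the slope is 1, hence S = S'.
module Submission where

open import Defs
open import Algebra.Definitions.RawMonoid using () renaming (_×_ to multiple)
open import Algebra.Morphism.Structures using (module MonoidMorphisms)
open import Data.Bool.Properties using (T?)
open import Data.Fin using (Fin; toℕ; fromℕ<)
open import Data.Fin.Properties using (pigeonhole; toℕ<n; toℕ-fromℕ<)
open import Data.List using (List; []; _∷_; [_]; _++_; length; take; drop; replicate; foldr)
open import Data.List.Extrema.Nat using (max; xs≤max; argmax-sel)
open import Data.List.Membership.Propositional using (_∈_; find; lose)
open import Data.List.Membership.Propositional.Properties
  using (∈-concatMap⁺; ∈-concatMap⁻; ∈-map⁺; ∈-map⁻)
open import Data.List.Properties
  using (length-take; length-drop; length-++; length-replicate; take++drop≡id)
open import Data.List.Relation.Unary.All as All using (All; []; _∷_)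
open import Data.List.Relation.Unary.All.Properties using (++⁺; ++⁻; replicate⁺)
open import Data.List.Relation.Unary.Any using (here; there)
open import Data.Nat
open import Data.Nat.DivMod using (_/_; _%_; m≡m%n+[m/n]*n; m%n<n)
open import Data.Nat.Divisibility
open import Data.Nat.GCD using (gcd; gcd-greatest; gcd-GCD; c*gcd[m,n]≡gcd[cm,cn]; module Bézout)
open import Data.Nat.ListAction using (sum)
open import Data.Nat.ListAction.Properties using (sum-++)
open import Data.Nat.Properties
open import Data.Nat.Tactic.RingSolver using (solve-∀)
open import Data.Product using (∃-syntax; ∃₂; _×_; _,_)
open import Data.Sum using (inj₁; inj₂)
open import Function.Base using (_∘_; id)
open import Function.Bundles using (_⇔_; mk⇔; module Equivalence)
open import Relation.Binary.PropositionalEquality hiding ([_])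
open import Relation.Nullary using (Dec; yes; no; contradiction)
open import Relation.Nullary.Decidable using (map′; _×-dec_; _→-dec_; ¬?)

open FinSub0
open Equivalence using (to; from)

-- Preliminaries on least witnesses, divisibility and lists.

least : {P : ℕ → Set} → (∀ n → Dec (P n)) → ∀ n → P n →
        ∃[ m ] (P m × (∀ k → P k → m ≤ k))
least P? zero p = 0 , p , λ _ _ → z≤n
least P? (suc n) p with P? 0
... | yes p₀ = 0 , p₀ , λ _ _ → z≤n
... | no ¬p₀ with m , pm , m-least ← least (P? ∘ suc) n p =
  suc m , pm , λ { zero p₀ → contradiction p₀ ¬p₀ ; (suc k) pk → s≤s (m-least k pk) }

-- Multiplication by `b` distributes over gcd. On a list with gcd 1 this yields `a ∣ b`, which is
-- how the gcd condition on a monoid gets used.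
gcd-list-∣ : ∀ a b xs → All (λ x → a ∣ b * x) xs → a ∣ b * foldr gcd 0 xs
gcd-list-∣ a b [] [] = subst (a ∣_) (sym (*-zeroʳ b)) (a ∣0)
gcd-list-∣ a b (x ∷ xs) (px ∷ pxs) =
  subst (a ∣_) (sym (c*gcd[m,n]≡gcd[cm,cn] b x (foldr gcd 0 xs)))
    (gcd-greatest px (gcd-list-∣ a b xs pxs))

take-+ : ∀ {A : Set} m n (xs : List A) → take (m + n) xs ≡ take m xs ++ take n (drop m xs)
take-+ zero n xs = refl
take-+ (suc m) zero [] = refl
take-+ (suc m) (suc n) [] = refl
take-+ (suc m) n (x ∷ xs) = cong (x ∷_) (take-+ m n xs)

%-≡⇒∣ : ∀ a .{{_ : NonZero a}} s t → s % a ≡ (s + t) % a → a ∣ t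
%-≡⇒∣ a s t eq = ∣m+n∣m⇒∣n (divides ((s + t) / a) (+-cancelˡ-≡ (s % a) _ _ shifted))
                            (n∣m*n (s / a))
  where
  open ≡-Reasoning
  shifted : s % a + (s / a * a + t) ≡ s % a + (s + t) / a * a
  shifted = begin
    s % a + (s / a * a + t)           ≡⟨ +-assoc (s % a) _ t ⟨
    s % a + s / a * a + t             ≡⟨ cong (_+ t) (m≡m%n+[m/n]*n s a) ⟨
    s + t                             ≡⟨ m≡m%n+[m/n]*n (s + t) a ⟩
    (s + t) % a + (s + t) / a * a     ≡⟨ cong (_+ (s + t) / a * a) eq ⟨
    s % a + (s + t) / a * a           ∎

-- Two of the prefix sums are congruent modulo a.
divisible-block : ∀ a .{{_ : NonZero a}} xs → a ≤ length xs →
  ∃[ us ] ∃[ vs ] ∃[ ws ] (xs ≡ us ++ vs ++ ws × 0 < length vs × a ∣ sum vs)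
divisible-block a xs a≤ with pigeonhole (n<1+n a) (λ i → fromℕ< (m%n<n (sum (take (toℕ i) xs)) a))
... | i , j , i<j , fi≡fj =
  take m xs , take d (drop m xs) , drop d (drop m xs) ,
  sym (trans (cong (take m xs ++_) (take++drop≡id d (drop m xs))) (take++drop≡id m xs)) ,
  nonempty , %-≡⇒∣ a (sum (take m xs)) _ congruent
  where
  m = toℕ i
  d = toℕ j ∸ m
  residue : Fin (suc a) → ℕ
  residue k = sum (take (toℕ k) xs) % a
  residue-eq : residue i ≡ residue j
  residue-eq = trans (sym (toℕ-fromℕ< (m%n<n (sum (take m xs)) a)))
                     (trans (cong toℕ fi≡fj) (toℕ-fromℕ< (m%n<n (sum (take (toℕ j) xs)) a)))
  congruent : sum (take m xs) % a ≡ (sum (take m xs) + sum (take d (drop m xs))) % a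
  congruent = trans residue-eq (cong (_% a) (begin
    sum (take (toℕ j) xs)                         ≡⟨ cong (λ k → sum (take k xs)) (m+[n∸m]≡n (<⇒≤ i<j)) ⟨
    sum (take (m + d) xs)                         ≡⟨ cong sum (take-+ m d xs) ⟩
    sum (take m xs ++ take d (drop m xs))         ≡⟨ sum-++ (take m xs) _ ⟩
    sum (take m xs) + sum (take d (drop m xs))    ∎))
    where open ≡-Reasoning
  -- `take` truncates silently, so `0 < d` alone is not enough: the block must also start before the
  -- end of `xs`, which holds as `m < toℕ j ≤ a ≤ length xs`.
  nonempty : 0 < length (take d (drop m xs))
  nonempty = subst (0 <_) (sym (trans (length-take d (drop m xs)) (cong (d ⊓_) (length-drop m xs))))
    (⊓-glb (m<n⇒0<n∸m i<j)
           (m<n⇒0<n∸m (<-≤-trans i<j (≤-trans (s≤s⁻¹ (toℕ<n j)) a≤))))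

sum≤length* : ∀ {a} xs → All (_≤ a) xs → sum xs ≤ length xs * a
sum≤length* [] [] = z≤n
sum≤length* (x ∷ xs) (px ∷ pxs) = +-mono-≤ px (sum≤length* xs pxs)

sum-replicate : ∀ n a → sum (replicate n a) ≡ n * a
sum-replicate zero a = refl
sum-replicate (suc n) a = cong (a +_) (sum-replicate n a)

-- Sumsets, n-fold sums and their maxima.

∈-sumset⁺ : ∀ {xs ys x y} → x ∈ xs → y ∈ ys → x + y ∈ sumset xs ys
∈-sumset⁺ {x = x} x∈ y∈ = ∈-concatMap⁺ _ (lose x∈ (∈-map⁺ (x +_) y∈))

∈-sumset⁻ : ∀ xs ys {z} → z ∈ sumset xs ys → ∃₂ λ x y → x ∈ xs × y ∈ ys × z ≡ x + y
∈-sumset⁻ xs ys z∈ with x , x∈ , z∈x+ys ← find (∈-concatMap⁻ _ {xs = xs} z∈)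
  with y , y∈ , refl ← ∈-map⁻ (x +_) z∈x+ys = x , y , x∈ , y∈ , refl

_≈_ : {S : NumericalMonoid} → FinSub0 S → FinSub0 S → Set
A ≈ B = ∀ n → n ∈ elems A ⇔ n ∈ elems B

_·_ : {S : NumericalMonoid} → ℕ → FinSub0 S → FinSub0 S
_·_ {S} = multiple (Pfin0 S)

-- Fewer than `n` summands suffice because 0 lies in `A` and pads the rest.
∈-·⁺ : ∀ {S} (A : FinSub0 S) n xs → All (_∈ elems A) xs → length xs ≤ n → sum xs ∈ elems (n · A)
∈-·⁺ A zero [] [] _ = here refl
∈-·⁺ A (suc n) [] [] _ = ∈-sumset⁺ (has0 A) (∈-·⁺ A n [] [] z≤n)
∈-·⁺ A (suc n) (x ∷ xs) (px ∷ pxs) (s≤s le) = ∈-sumset⁺ px (∈-·⁺ A n xs pxs le)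

∈-·⁻ : ∀ {S} (A : FinSub0 S) n {z} → z ∈ elems (n · A) →
  ∃[ xs ] (All (_∈ elems A) xs × length xs ≡ n × sum xs ≡ z)
∈-·⁻ A zero (here refl) = [] , [] , refl , refl
∈-·⁻ A (suc n) z∈ with x , y , x∈ , y∈ , refl ← ∈-sumset⁻ (elems A) (elems (n · A)) z∈
  with xs , pxs , len , refl ← ∈-·⁻ A n y∈ = x ∷ xs , x∈ ∷ pxs , cong suc len , refl

-- The default value 0 is harmless: 0 is a member of `A`, so the maximum is always attained.
maxElem : {S : NumericalMonoid} → FinSub0 S → ℕ
maxElem A = max 0 (elems A)

≤maxElem : ∀ {S} (A : FinSub0 S) {x} → x ∈ elems A → x ≤ maxElem A
≤maxElem A = All.lookup (xs≤max 0 (elems A))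

maxElem∈ : ∀ {S} (A : FinSub0 S) → maxElem A ∈ elems A
maxElem∈ A with argmax-sel id 0 (elems A)
... | inj₁ eq = subst (_∈ elems A) (sym eq) (has0 A)
... | inj₂ m∈ = m∈

maxElem∈S : ∀ {S} (A : FinSub0 S) → maxElem A ∈S S
maxElem∈S A = All.lookup (⊆S A) (maxElem∈ A)

maxElem-cong : ∀ {S} (A B : FinSub0 S) → A ≈ B → maxElem A ≡ maxElem B
maxElem-cong A B A≈B = ≤-antisym (≤maxElem B (to (A≈B _) (maxElem∈ A)))
                                 (≤maxElem A (from (A≈B _) (maxElem∈ B)))

maxElem-⊕ : ∀ {S} (A B : FinSub0 S) → maxElem (A ⊕ B) ≡ maxElem A + maxElem B
maxElem-⊕ A B = ≤-antisym upper (≤maxElem (A ⊕ B) (∈-sumset⁺ (maxElem∈ A) (maxElem∈ B)))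
  where
  upper : maxElem (A ⊕ B) ≤ maxElem A + maxElem B
  upper with x , y , x∈ , y∈ , eq ← ∈-sumset⁻ (elems A) (elems B) (maxElem∈ (A ⊕ B)) =
    ≤-trans (≤-reflexive eq) (+-mono-≤ (≤maxElem A x∈) (≤maxElem B y∈))

maxElem-· : ∀ {S} n (A : FinSub0 S) → maxElem (n · A) ≡ n * maxElem A
maxElem-· zero A = refl
maxElem-· (suc n) A = trans (maxElem-⊕ A (n · A)) (cong (maxElem A +_) (maxElem-· n A))

-- The sets {0,a} and absorption.

pair : ∀ {S a} → a ∈S S → FinSub0 S
pair {S} {a} a∈ = fs (0 ∷ a ∷ []) (NumericalMonoid.zero∈ S ∷ a∈ ∷ []) (here refl)

maxElem-pair : ∀ {S a} (a∈ : a ∈S S) → maxElem (pair {S} a∈) ≡ a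
maxElem-pair {S} {a} a∈ = ≤-antisym (bound (maxElem∈ P)) (≤maxElem P (there (here refl)))
  where
  P = pair {S} a∈
  bound : ∀ {x} → x ∈ elems P → x ≤ a
  bound (here refl) = z≤n
  bound (there (here refl)) = ≤-refl

-- A block of ys with sum q · a is traded for q copies of a; one of these
-- copies, or a freed zero if q = 0, is the summand from {0,a}.
pair-absorbs : ∀ {S} (A : FinSub0 S) →
  (pair {S} (maxElem∈S A) ⊕ (maxElem A · A)) ≈ (A ⊕ (maxElem A · A))
pair-absorbs {S} A z = mk⇔ forward backward
  where
  a = maxElem A
  aA = maxElem A · A
  P = pair {S} (maxElem∈S A)
  P⊆A : ∀ {x} → x ∈ elems P → x ∈ elems A
  P⊆A (here refl) = has0 A
  P⊆A (there (here refl)) = maxElem∈ A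

  forward : z ∈ elems (P ⊕ aA) → z ∈ elems (A ⊕ aA)
  forward z∈ with x , y , x∈ , y∈ , refl ← ∈-sumset⁻ (elems P) (elems aA) z∈ =
    ∈-sumset⁺ {elems A} {elems aA} (P⊆A x∈) y∈

  trade : ∀ ys → All (_∈ elems A) ys → length ys ≡ suc a →
          ∃[ us ] ∃[ vs ] ∃[ ws ] (ys ≡ us ++ vs ++ ws × 0 < length vs × a ∣ sum vs) →
          .{{_ : NonZero a}} → sum ys ∈ elems (P ⊕ aA)
  trade ys pys len (us , vs , ws , refl , 0<v , divides q eq)
    with pus , pvws ← ++⁻ us pys
    with pvs , pws ← ++⁻ vs pvws = result q refl
    where
    lengths : length us + (length vs + length ws) ≡ suc a
    lengths = trans (sym (trans (length-++ us) (cong (length us +_) (length-++ vs)))) len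
    -- No entry of the block exceeds `a`, so `q` copies of `a` are never more numerous than the
    -- entries they replace.
    q≤v : q ≤ length vs
    q≤v = *-cancelʳ-≤ q (length vs) a
            (subst (_≤ length vs * a) eq (sum≤length* vs (All.map (≤maxElem A) pvs)))
    sums : sum (us ++ vs ++ ws) ≡ sum us + (q * a + sum ws)
    sums = trans (sum-++ us (vs ++ ws))
             (cong (sum us +_) (trans (sum-++ vs ws) (cong (_+ sum ws) eq)))

    -- Of the `suc a` summands at least one must be freed, since `aA` has room for only `a`; keeping
    -- `r < length vs` copies achieves this.
    bound : ∀ r → suc r ≤ length vs → length (us ++ replicate r a ++ ws) ≤ a
    bound r r<v = s≤s⁻¹ (begin
      suc (length (us ++ replicate r a ++ ws))
        ≡⟨ cong suc (length-++ us) ⟩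
      suc (length us + length (replicate r a ++ ws))
        ≡⟨ cong (λ l → suc (length us + l)) (length-++ (replicate r a)) ⟩
      suc (length us + (length (replicate r a) + length ws))
        ≡⟨ cong (λ l → suc (length us + (l + length ws))) (length-replicate r) ⟩
      suc (length us + (r + length ws))
        ≡⟨ +-suc (length us) (r + length ws) ⟨
      length us + (suc r + length ws)
        ≤⟨ +-monoʳ-≤ (length us) (+-monoˡ-≤ (length ws) r<v) ⟩
      length us + (length vs + length ws)
        ≡⟨ lengths ⟩
      suc a ∎)
      where open ≤-Reasoning

    member : ∀ r → suc r ≤ length vs → sum us + (r * a + sum ws) ∈ elems aA
    member r r<v = subst (_∈ elems aA)
      (trans (sum-++ us _) (cong (sum us +_) (trans (sum-++ (replicate r a) ws)
        (cong (_+ sum ws) (sum-replicate r a)))))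
      (∈-·⁺ A a _ (++⁺ pus (++⁺ (replicate⁺ r (maxElem∈ A)) pws)) (bound r r<v))

    rearrange : ∀ a s t w → a + (s + (t + w)) ≡ s + (a + t + w)
    rearrange = solve-∀

    result : ∀ r → r ≡ q → sum (us ++ vs ++ ws) ∈ elems (P ⊕ aA)
    -- Here the nonemptiness of the block is essential: with `q = 0` only a discarded entry of `vs`
    -- makes room.
    result zero refl = subst (_∈ elems (P ⊕ aA)) (sym sums)
      (∈-sumset⁺ {elems P} {elems aA} {x = 0} (here refl) (member 0 0<v))
    result (suc r) refl = subst (_∈ elems (P ⊕ aA))
      (trans (rearrange a (sum us) (r * a) (sum ws)) (sym sums))
      (∈-sumset⁺ {elems P} {elems aA} (there (here refl)) (member r q≤v))

  backward : z ∈ elems (A ⊕ aA) → z ∈ elems (P ⊕ aA)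
  backward z∈ with a ≟ 0
  ... | yes a≡0 with x , y , x∈ , y∈ , refl ← ∈-sumset⁻ (elems A) (elems aA) z∈ =
    ∈-sumset⁺ {elems P} {elems aA} (here (n≤0⇒n≡0 (subst (x ≤_) a≡0 (≤maxElem A x∈)))) y∈
  -- `A ⊕ aA` is by definition `suc a · A`, so `z` is a sum of exactly `suc a` elements of `A`.
  ... | no a≢0 with ys , pys , len , refl ← ∈-·⁻ A (suc a) z∈ =
    trade ys pys len (divisible-block a ys (≤-trans (n≤1+n a) (≤-reflexive (sym len))))
    where instance _ = ≢-nonZero a≢0

-- Maxima under an isomorphism.

module Isomorphism {S S' : NumericalMonoid} (φ : FinSub0 S → FinSub0 S')
  (iso : MonoidMorphisms.IsMonoidIsomorphism (Pfin0 S) (Pfin0 S') φ) where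

  open MonoidMorphisms.IsMonoidIsomorphism iso using (⟦⟧-cong; homo; ε-homo; surjective)
  open ≡-Reasoning

  max-φ-⊕ : ∀ A B → maxElem (φ (A ⊕ B)) ≡ maxElem (φ A) + maxElem (φ B)
  max-φ-⊕ A B = trans (maxElem-cong (φ (A ⊕ B)) (φ A ⊕ φ B) (homo A B)) (maxElem-⊕ (φ A) (φ B))

  max-φ-· : ∀ n A → maxElem (φ (n · A)) ≡ n * maxElem (φ A)
  max-φ-· zero A = maxElem-cong (φ (0 · A)) (0 · φ A) ε-homo
  max-φ-· (suc n) A = trans (max-φ-⊕ A (n · A)) (cong (maxElem (φ A) +_) (max-φ-· n A))

  -- The summand `K` in `pair-absorbs` cannot be cancelled between sets, but it can be cancelled
  -- between maxima, which are natural numbers adding under `⊕`.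
  max-φ-pair : ∀ A → maxElem (φ (pair {S} (maxElem∈S A))) ≡ maxElem (φ A)
  max-φ-pair A = +-cancelʳ-≡ (maxElem (φ K)) _ _ (begin
    maxElem (φ P) + maxElem (φ K)  ≡⟨ max-φ-⊕ P K ⟨
    maxElem (φ (P ⊕ K))            ≡⟨ maxElem-cong (φ (P ⊕ K)) (φ (A ⊕ K)) (⟦⟧-cong {P ⊕ K} {A ⊕ K} (pair-absorbs A)) ⟩
    maxElem (φ (A ⊕ K))            ≡⟨ max-φ-⊕ A K ⟩
    maxElem (φ A) + maxElem (φ K)  ∎)
    where
    P = pair {S} (maxElem∈S A)
    K = maxElem A · A

  max-φ-determined : ∀ A B → maxElem A ≡ maxElem B → maxElem (φ A) ≡ maxElem (φ B)
  max-φ-determined A B eq = begin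
    maxElem (φ A)  ≡⟨ max-φ-pair A ⟨
    maxElem (φ P)  ≡⟨ maxElem-cong (φ P) (φ Q) (⟦⟧-cong {P} {Q} P≈Q) ⟩
    maxElem (φ Q)  ≡⟨ max-φ-pair B ⟩
    maxElem (φ B)  ∎
    where
    P = pair {S} (maxElem∈S A)
    Q = pair {S} (maxElem∈S B)
    P≈Q : P ≈ Q
    P≈Q n = mk⇔ (subst (λ m → n ∈ 0 ∷ m ∷ []) eq) (subst (λ m → n ∈ 0 ∷ m ∷ []) (sym eq))

  -- Linearity in cross-multiplied form, which avoids a rational slope: `maxElem B` copies of `A`
  -- and `maxElem A` copies of `B` have the same maximum, hence so do their images.
  max-φ-proportional : ∀ A B → maxElem B * maxElem (φ A) ≡ maxElem A * maxElem (φ B)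
  max-φ-proportional A B = begin
    maxElem B * maxElem (φ A)    ≡⟨ max-φ-· (maxElem B) A ⟨
    maxElem (φ (maxElem B · A))  ≡⟨ max-φ-determined (maxElem B · A) (maxElem A · B) same-max ⟩
    maxElem (φ (maxElem A · B))  ≡⟨ max-φ-· (maxElem A) B ⟩
    maxElem A * maxElem (φ B)    ∎
    where
    same-max : maxElem (maxElem B · A) ≡ maxElem (maxElem A · B)
    same-max = trans (maxElem-· (maxElem B) A)
      (trans (*-comm (maxElem B) (maxElem A)) (sym (maxElem-· (maxElem A) B)))

  -- Proportionality against {0,x} shows that max A divides max φ(A) · x for every x in S; gcd 1 in
  -- S then removes the factor x. So the slope is an integer.
  max-∣-max-φ : ∀ A → maxElem A ∣ maxElem (φ A)
  max-∣-max-φ A with xs , xs⊆S , gcd≡1 ← NumericalMonoid.gcd≡1 S =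
    subst (maxElem A ∣_) (trans (cong (maxElem (φ A) *_) gcd≡1) (*-identityʳ _))
      (gcd-list-∣ (maxElem A) (maxElem (φ A)) xs (All.map divides-multiple xs⊆S))
    where
    divides-multiple : ∀ {x} → x ∈S S → maxElem A ∣ maxElem (φ A) * x
    divides-multiple {x} x∈ = divides (maxElem (φ (pair {S} x∈))) (begin
      maxElem (φ A) * x                         ≡⟨ *-comm (maxElem (φ A)) x ⟩
      x * maxElem (φ A)                         ≡⟨ cong (_* maxElem (φ A)) (maxElem-pair {S} x∈) ⟨
      maxElem (pair {S} x∈) * maxElem (φ A)     ≡⟨ max-φ-proportional A (pair {S} x∈) ⟩
      maxElem A * maxElem (φ (pair {S} x∈))     ≡⟨ *-comm (maxElem A) _ ⟩
      maxElem (φ (pair {S} x∈)) * maxElem A     ∎)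

  -- Surjectivity realises every element of S' as a maximum of some φ(X), which lets facts about S'
  -- be pulled back without constructing an inverse of φ.
  preimage-pair : ∀ {y} → y ∈S S' → ∃[ X ] (maxElem (φ X) ≡ y)
  preimage-pair {y} y∈ with X , φX≈ ← surjective (pair {S'} y∈) =
    X , trans (maxElem-cong (φ X) (pair {S'} y∈) (φX≈ {X} (λ _ → mk⇔ id id))) (maxElem-pair {S'} y∈)

  -- The mirror argument: with y = max φ(X), proportionality gives max A · y = max X · max φ(A), and
  -- gcd 1 in S' removes the factor y.
  max-φ-∣-max : ∀ A → maxElem (φ A) ∣ maxElem A
  max-φ-∣-max A with ys , ys⊆S' , gcd≡1 ← NumericalMonoid.gcd≡1 S' =
    subst (maxElem (φ A) ∣_) (trans (cong (maxElem A *_) gcd≡1) (*-identityʳ _))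
      (gcd-list-∣ (maxElem (φ A)) (maxElem A) ys (All.map divides-multiple ys⊆S'))
    where
    divides-multiple : ∀ {y} → y ∈S S' → maxElem (φ A) ∣ maxElem A * y
    divides-multiple y∈ with X , refl ← preimage-pair y∈ =
      divides (maxElem X) (sym (max-φ-proportional A X))

  max-φ : ∀ A → maxElem (φ A) ≡ maxElem A
  max-φ A = ∣-antisym (max-φ-∣-max A) (max-∣-max-φ A)

  -- An element n of S is the maximum of {0,n}, hence also of φ({0,n}), whose members lie in S'.
  -- Conversely an element of S' is some max φ(X) = max X, which lies in S.
  S≐S' : S ≐ S'
  S≐S' n = mk⇔ S⊆S' S'⊆S
    where
    S⊆S' : n ∈S S → n ∈S S'
    S⊆S' n∈ = subst (_∈S S') (trans (max-φ (pair {S} n∈)) (maxElem-pair {S} n∈))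
                    (maxElem∈S (φ (pair {S} n∈)))
    S'⊆S : n ∈S S' → n ∈S S
    S'⊆S n∈ with X , refl ← preimage-pair n∈ = subst (_∈S S) (sym (max-φ X)) (maxElem∈S X)

-- Cofiniteness of S and existence of m(S).

module _ (S : NumericalMonoid) where

  open NumericalMonoid S

  *-closed : ∀ n {x} → x ∈S S → (n * x) ∈S S
  *-closed zero x∈ = zero∈
  *-closed (suc n) x∈ = +-closed x∈ (*-closed n x∈)

  -- The gcd itself need not lie in S, but by Bézout it is a difference of two elements of S. For
  -- gcd 1 these are consecutive.
  gap-gcd : ∀ xs → All (_∈S S) xs → ∃[ u ] (u ∈S S × (foldr gcd 0 xs + u) ∈S S)
  gap-gcd [] [] = 0 , zero∈ , zero∈
  gap-gcd (x ∷ xs) (x∈ ∷ xs⊆S) with u , u∈ , g+u∈ ← gap-gcd xs xs⊆S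
    with Bézout.identity (gcd-GCD x (foldr gcd 0 xs))
  -- Here `d + q * g ≡ p * x`. Adding `q * u` to both sides turns `q * g`, possibly outside S, into
  -- `q * (g + u)`, which lies in S. The other sign is treated in the same way.
  ... | Bézout.+- p q eq =
    q * (foldr gcd 0 xs + u) , *-closed q g+u∈ ,
    subst (_∈S S) (begin
      p * x + q * u                ≡⟨ cong (_+ q * u) eq ⟨
      d + q * g + q * u            ≡⟨ regroup d q g u ⟩
      d + q * (g + u)              ∎)
      (+-closed (*-closed p x∈) (*-closed q u∈))
    where
    open ≡-Reasoning
    g = foldr gcd 0 xs
    d = gcd x g
    regroup : ∀ d q g u → d + q * g + q * u ≡ d + q * (g + u)
    regroup = solve-∀
  ... | Bézout.-+ p q eq =
    p * x + q * u , +-closed (*-closed p x∈) (*-closed q u∈) ,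
    subst (_∈S S) (begin
      q * (g + u)                  ≡⟨ *-distribˡ-+ q g u ⟩
      q * g + q * u                ≡⟨ cong (_+ q * u) eq ⟨
      d + p * x + q * u            ≡⟨ +-assoc d (p * x) (q * u) ⟩
      d + (p * x + q * u)          ∎)
      (*-closed q g+u∈)
    where
    open ≡-Reasoning
    g = foldr gcd 0 xs
    d = gcd x g

  -- Divide n by u + 1 and write the remainder as u - d. Then n = (q - d)(u + 1) + (d + 1)u, and n ≥
  -- u(u + 1) forces q ≥ u ≥ d, so both coefficients are natural numbers.
  consecutive⇒cofinite : ∀ {u} → u ∈S S → suc u ∈S S → ∀ n → u * suc u ≤ n → n ∈S S
  consecutive⇒cofinite {u} u∈ 1+u∈ n le =
    subst (_∈S S) (sym n-decomposed) (+-closed (*-closed e 1+u∈) (*-closed (suc d) u∈))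
    where
    r = n % suc u
    q = n / suc u
    d = u ∸ r
    e = q ∸ d
    u≡ : r + d ≡ u
    u≡ = m+[n∸m]≡n (s≤s⁻¹ (m%n<n n (suc u)))
    u≤q : u ≤ q
    u≤q = s≤s⁻¹ (*-cancelʳ-< (suc u) u (suc q) (begin-strict
      u * suc u           ≤⟨ le ⟩
      n                   ≡⟨ m≡m%n+[m/n]*n n (suc u) ⟩
      r + q * suc u       <⟨ +-monoˡ-< (q * suc u) (m%n<n n (suc u)) ⟩
      suc q * suc u       ∎))
      where open ≤-Reasoning
    q≡ : d + e ≡ q
    q≡ = m+[n∸m]≡n (≤-trans (m∸n≤m u r) u≤q)
    regroup : ∀ r d e → r + (d + e) * suc (r + d) ≡ e * suc (r + d) + suc d * (r + d)
    regroup = solve-∀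
    n-decomposed : n ≡ e * suc u + suc d * u
    n-decomposed = begin
      n                                      ≡⟨ m≡m%n+[m/n]*n n (suc u) ⟩
      r + q * suc u                          ≡⟨ cong₂ (λ v w → r + v * suc w) q≡ u≡ ⟨
      r + (d + e) * suc (r + d)              ≡⟨ regroup r d e ⟩
      e * suc (r + d) + suc d * (r + d)      ≡⟨ cong (λ w → e * suc w + suc d * w) u≡ ⟩
      e * suc u + suc d * u                  ∎
      where open ≡-Reasoning

  conductor : ∃[ c ] (∀ n → c ≤ n → n ∈S S)
  conductor with xs , xs⊆S , gcd≡1 ← gcd≡1
    with u , u∈ , g+u∈ ← gap-gcd xs xs⊆S =
    u * suc u , consecutive⇒cofinite u∈ (subst (λ g → (g + u) ∈S S) gcd≡1 g+u∈)

  -- Any larger `a` splits off `suc c`, leaving a remainder beyond the conductor. Using `suc c`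
  -- instead of `c` keeps both parts nonzero even when `c` is 0.
  atom-bound : ∀ c → (∀ n → c ≤ n → n ∈S S) → ∀ a → IsAtom S a → a < suc c + suc c
  atom-bound c c-conductor a (_ , _ , indecomposable) = ≰⇒> λ 2+2c≤a →
    let 1+c≤a∸1+c = m+n≤o⇒m≤o∸n (suc c) 2+2c≤a in
    indecomposable (suc c , a ∸ suc c ,
      c-conductor (suc c) (n≤1+n c) ,
      c-conductor (a ∸ suc c) (≤-trans (n≤1+n c) 1+c≤a∸1+c) ,
      (λ ()) , (>⇒≢ (≤-trans (s≤s z≤n) 1+c≤a∸1+c)) ,
      m+[n∸m]≡n (m+n≤o⇒m≤o (suc c) 2+2c≤a))

  decomposable? : ∀ a → Dec (∃[ b ] ∃[ c ] (b ∈S S × c ∈S S × b ≢ 0 × c ≢ 0 × b + c ≡ a))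
  decomposable? a = map′
    (λ (b , _ , split) → b , a ∸ b , split)
    (λ { (b , c , b∈ , c∈ , b≢0 , c≢0 , refl) →
         b , s≤s (m≤m+n b c) ,
         subst (λ d → b ∈S S × d ∈S S × b ≢ 0 × d ≢ 0 × b + d ≡ b + c)
           (sym (m+n∸m≡n b c)) (b∈ , c∈ , b≢0 , c≢0 , refl) })
    (anyUpTo? (λ b → T? (mem b) ×-dec T? (mem (a ∸ b)) ×-dec ¬? (b ≟ 0) ×-dec ¬? (a ∸ b ≟ 0)
                      ×-dec b + (a ∸ b) ≟ a)
              (suc a))

  isAtom? : ∀ a → Dec (IsAtom S a)
  isAtom? a = T? (mem a) ×-dec ¬? (a ≟ 0) ×-dec ¬? (decomposable? a)

  -- The bound `N` reduces the quantifier over all atoms to a finite search.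
  mCond? : ∀ N → (∀ a → IsAtom S a → a < N) → ∀ m → Dec (MCond S m)
  mCond? N atoms<N zero = no λ ()
  mCond? N atoms<N (suc k) =
    map′ (λ bounded a atom → bounded (atoms<N a atom) atom) (λ bounded {a} _ → bounded a)
         (allUpTo? (λ a → isAtom? a →-dec a ≤? suc k) N)
    ×-dec T? (mem (suc k)) ×-dec T? (mem k)

  -- Equality of m(S) and m(S') is expressed by a common value, so one has to be exhibited.
  m-exists : ∃[ m ] IsMS S m
  m-exists with c , c-conductor ← conductor =
    -- The search may start from `suc N`: `N` exceeds every atom, and both `N` and `suc N` are past
    -- the conductor.
    least (mCond? N atoms<N) (suc N)
      ((λ a atom → ≤-trans (<⇒≤ (atoms<N a atom)) (n≤1+n N)) ,
       c-conductor (suc N) (≤-trans c≤N (n≤1+n N)) , c-conductor N c≤N)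
    where
    N = suc c + suc c
    atoms<N = atom-bound c c-conductor
    c≤N : c ≤ N
    c≤N = ≤-trans (n≤1+n c) (m≤m+n (suc c) (suc c))

-- Transport of the invariants along equality of monoids, and the theorem.

≐-sym : ∀ {S S'} → S ≐ S' → S' ≐ S
≐-sym eq n = mk⇔ (from (eq n)) (to (eq n))

IsAtom-resp-≐ : ∀ {S S'} → S ≐ S' → ∀ {a} → IsAtom S a → IsAtom S' a
IsAtom-resp-≐ eq (a∈ , a≢0 , indecomposable) =
  to (eq _) a∈ , a≢0 ,
  λ (b , c , b∈ , c∈ , rest) → indecomposable (b , c , from (eq b) b∈ , from (eq c) c∈ , rest)

MCond-resp-≐ : ∀ {S S'} → S ≐ S' → ∀ m → MCond S m → MCond S' m
MCond-resp-≐ {S} {S'} eq (suc k) (bounded , 1+k∈ , k∈) =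
  (λ a atom → bounded a (IsAtom-resp-≐ {S'} {S} (≐-sym {S} {S'} eq) atom)) , to (eq _) 1+k∈ , to (eq _) k∈

IsMS-resp-≐ : ∀ {S S'} → S ≐ S' → ∀ {m} → IsMS S m → IsMS S' m
IsMS-resp-≐ {S} {S'} eq (cond , minimal) =
  MCond-resp-≐ {S} {S'} eq _ cond ,
  λ m' cond' → minimal m' (MCond-resp-≐ {S'} {S} (≐-sym {S} {S'} eq) m' cond')

SameCard-atoms : ∀ {S S'} → S ≐ S' → SameCard (IsAtom S) (IsAtom S')
SameCard-atoms {S} {S'} eq =
  (λ (a , atom) → a , IsAtom-resp-≐ {S} {S'} eq atom) ,
  (λ (a , atom) → a , IsAtom-resp-≐ {S'} {S} (≐-sym {S} {S'} eq) atom) ,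
  (λ _ → refl) , (λ _ → refl)

≅P⇒≐ : ∀ {S S'} → S ≅P S' → S ≐ S'
≅P⇒≐ {S} {S'} (φ , iso) = Isomorphism.S≐S' {S} {S'} φ iso

theorem4p8 : (S : NumericalMonoid) →
    ((S' : NumericalMonoid) → S' ≅P S →
    SameCard (IsAtom S) (IsAtom S') × ∃[ m ] (IsMS S m × IsMS S' m))
    × ∃[ L ] ((S' : NumericalMonoid) → S' ≅P S → ∃[ T ] (T ∈ L × S' ≐ T))
-- The finite list for the second part is `S` alone, since an isomorphism already forces `S' ≐ S`.
theorem4p8 S = part₁ , [ S ] , λ S' S'≅S → S , here refl , ≅P⇒≐ {S'} {S} S'≅S
  where
  same-m : ∀ {S'} → S ≐ S' → ∃[ m ] IsMS S m → ∃[ m ] (IsMS S m × IsMS S' m)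
  same-m {S'} S≐S' (m , isMS) = m , isMS , IsMS-resp-≐ {S} {S'} S≐S' isMS

  part₁ : (S' : NumericalMonoid) → S' ≅P S →
          SameCard (IsAtom S) (IsAtom S') × ∃[ m ] (IsMS S m × IsMS S' m)
  part₁ S' S'≅S = SameCard-atoms {S} {S'} S≐S' , same-m {S'} S≐S' (m-exists S)
    where
    S≐S' : S ≐ S'
    S≐S' = ≐-sym {S'} {S} (≅P⇒≐ {S'} {S} S'≅S)
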